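{- For every integer $n\geq 0$, \[ b_{n}^{(2)}(x)=\sum_{l=0}^{n}\binom{n}{l}\frac{B_{l}\,b_{n-l}(x)}{l+1}. \]
   Context: For $k\in\mathbb{Z}$, the polylogarithm is $Li_k(x)=\sum_{n=1}^{\infty}\frac{x^n}{n^k}$. The poly-Bernoulli polynomials of the second kind $b_n^{(k)}(x)$ are defined by the generating function \[ \frac{Li_{k}(1-e^{ -t})}{\log(1+t)}(1+t)^{x}=\sum_{n=0}^{\infty}b_{n}^{(k)}(x)\frac{t^{n}}{n!}. \] The Bernoulli polynomials of the second kind $b_n(x)$ are defined by $\frac{t}{\log(1+t)}(1+t)^x=\sum_{n=0}^{\infty}b_n(x)\frac{t^n}{n!}$. The Bernoulli numbers $B_n$ are defined by $\frac{t}{e^t-1}=\sum_{n=0}^{\infty}B_n\frac{t^n}{n!}$. -}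

module Defs where

open import Algebra.Bundles using (CommutativeRing)
open import Algebra.Morphism.Structures using (IsRingHomomorphism)
open import Data.Fin.Base using (toℕ)
open import Data.Integer.Base using (ℤ; +_; -[1+_])
open import Data.Nat.Base using (ℕ; zero; suc; _∸_; _!)
open import Data.Nat.Properties using (_!≢0)
open import Data.Rational.Base as ℚ using (ℚ; 0ℚ; 1ℚ; _/_; 1/_; NonZero)
import Data.Rational.Properties as ℚ
open import Level using (_⊔_)
import Level
open import Algebra.Definitions.RawSemiring ℚ.+-*-rawSemiring using (_^_)

fromℕ : ℕ → ℚ
fromℕ n = + n / 1

1/_! : ℕ → ℚ
1/ n ! = (+ 1 / (n !)) {{n !≢0}}

-- f : PowerSeries stands for the formal power series Σ f n · tⁿ.

module Series {c ℓ} (R : CommutativeRing c ℓ) where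

  open CommutativeRing R using (Carrier; _*_; -_; 0#; 1#; semiring)
    renaming (_+_ to _+ᴿ_)
  open import Algebra.Properties.Semiring.Sum semiring using (sum⁺-syntax)

  PowerSeries : Set c
  PowerSeries = ℕ → Carrier

  infixl 7 _·_
  infixl 6 _-ˢ_
  infixr 8 _^ˢ_

  one : PowerSeries
  one zero    = 1#
  one (suc _) = 0#

  _-ˢ_ : PowerSeries → PowerSeries → PowerSeries
  (f -ˢ g) n = f n +ᴿ - g n

  _·_ : PowerSeries → PowerSeries → PowerSeries
  (f · g) n = ∑[ i ≤ n ] (f (toℕ i) * g (n ∸ toℕ i))

  _^ˢ_ : PowerSeries → ℕ → PowerSeries
  f ^ˢ zero  = one
  f ^ˢ suc m = f · (f ^ˢ m)

  -- f(g(t)), meaningful only when g 0 = 0: then gᵐ has no terms below tᵐ,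
  -- so cutting the sum off at m = n loses nothing.
  compose : PowerSeries → PowerSeries → PowerSeries
  compose f g n = ∑[ m ≤ n ] (f (toℕ m) * (g ^ˢ toℕ m) n)

open Series ℚ.+-*-commutativeRing

-- f(t)/t, for f 0 = 0.
divT : PowerSeries → PowerSeries
divT f n = f (suc n)

scale : ℚ → PowerSeries → PowerSeries
scale a f n = a ℚ.* f n

-- With a = g 0 and h = 1 - g/a, this is 1/g = (1/a) · 1/(1 - h) = (1/a) · Σ hᵐ.
inverse : (g : PowerSeries) → .{{NonZero (g 0)}} → PowerSeries
inverse g = scale (1/ g 0) (compose (λ _ → 1ℚ) (one -ˢ scale (1/ g 0) g))

-- f/g for series f, g with zero constant term, g having nonzero linear term:
-- a factor t is cancelled from both.
quotient : (f g : PowerSeries) → .{{NonZero (g 1)}} → PowerSeries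
quotient f g = divT f · inverse (divT g)

T : PowerSeries
T zero          = 0ℚ
T (suc zero)    = 1ℚ
T (suc (suc _)) = 0ℚ

-- exp[ a ] is e^(at).
exp[_] : ℚ → PowerSeries
exp[ a ] n = a ^ n ℚ.* 1/ n !

log[1+t] : PowerSeries
log[1+t] zero    = 0ℚ
log[1+t] (suc n) = (ℚ.- 1ℚ) ^ n ℚ.* (+ 1 / suc n)

Li : ℤ → PowerSeries
Li k        zero    = 0ℚ
Li (+ j)    (suc m) = (+ 1 / suc m) ^ j
Li -[1+ j ] (suc m) = fromℕ (suc m) ^ suc j

-- t/(eᵗ - 1) = Σ Bₙ tⁿ/n!
bernoulli : ℕ → ℚ
bernoulli n = fromℕ (n !) ℚ.* quotient T (exp[ 1ℚ ] -ˢ one) n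

record ℚ-Algebra c ℓ : Set (Level.suc (c ⊔ ℓ)) where
  field
    commutativeRing : CommutativeRing c ℓ
  open CommutativeRing commutativeRing public
  field
    ι                    : ℚ → Carrier
    ι-isRingHomomorphism : IsRingHomomorphism ℚ.+-*-rawRing rawRing ι

-- The variable x is an arbitrary element of a commutative ℚ-algebra A, and the
-- generating functions live in A[[t]].  A = ℚ[X], x = X gives identities of
-- polynomials; A = ℝ or ℂ gives identities of polynomial functions.

module SecondKind {c ℓ} (A : ℚ-Algebra c ℓ) where

  open ℚ-Algebra A using (Carrier; _*_; _-_; 1#; ι; commutativeRing; semiring)
  open import Algebra.Properties.Semiring.Sum semiring public using (sum⁺-syntax)
  open Series commutativeRing using () renaming (PowerSeries to PowerSeriesᴬ; _·_ to _·ᴬ_)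

  -- x (x - 1) ⋯ (x - n + 1)
  fallingFactorial : Carrier → ℕ → Carrier
  fallingFactorial x zero    = 1#
  fallingFactorial x (suc n) = fallingFactorial x n * (x - ι (fromℕ n))

  [1+t]^_ : Carrier → PowerSeriesᴬ
  ([1+t]^ x) n = ι (1/ n !) * fallingFactorial x n

  extend : PowerSeries → PowerSeriesᴬ
  extend f n = ι (f n)

  -- t/log(1+t) · (1+t)ˣ = Σ bₙ(x) tⁿ/n!
  bernoulli₂ : ℕ → Carrier → Carrier
  bernoulli₂ n x =
    ι (fromℕ (n !)) * (extend (quotient T log[1+t]) ·ᴬ ([1+t]^ x)) n

  -- Liₖ(1-e⁻ᵗ)/log(1+t) · (1+t)ˣ = Σ bₙ⁽ᵏ⁾(x) tⁿ/n!
  polyBernoulli₂ : ℤ → ℕ → Carrier → Carrier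
  polyBernoulli₂ k n x =
    ι (fromℕ (n !)) *
    (extend (quotient (compose (Li k) (one -ˢ exp[ ℚ.- 1ℚ ])) log[1+t]) ·ᴬ ([1+t]^ x)) n

{-# OPTIONS --safe #-}
module Submission where

-- Let F = Li₂(1 - e⁻ᵗ).  Since Li₁′(x) = 1/(1 - x), the chain rule gives Li₁(1 - e⁻ᵗ) = t, and
-- since x Li₂′(x) = Li₁(x), it then gives (1 - e⁻ᵗ) F′ = t e⁻ᵗ, i.e. F′ = t/(eᵗ - 1).  So F/t has
-- coefficients Bₗ/(l + 1)!, and multiplying it by the generating function of the bₙ(x) proves
-- the formula.

open import Defs
open import Algebra.Bundles using (CommutativeRing)
import Algebra.Construct.Pointwise as Pointwise
open import Algebra.Morphism.Structures using (IsRingHomomorphism)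
import Algebra.Properties.CommutativeSemigroup as CommutativeSemigroupProperties
import Algebra.Properties.Ring as RingProperties
import Algebra.Properties.Semiring.Sum as SemiringSum
open import Data.Fin.Base using (toℕ)
import Data.Fin.Properties as Fin
open import Data.Integer.Base as ℤ using (+_)
import Data.Integer.Properties as ℤ
open import Data.Nat.Base as ℕ using (ℕ; zero; suc; _∸_; _≤_; _<_; z≤n; s≤s; _!)
open import Data.Nat.Combinatorics using (_C_; nCk≡n!/k![n-k]!; k![n∸k]!∣n!)
open import Data.Nat.DivMod using (m/n*n≡m)
import Data.Nat.Properties as ℕ
open import Data.Product.Base using (_,_)
open import Data.Rational.Base as ℚ using (ℚ; 0ℚ; 1ℚ; _/_; toℚᵘ)
import Data.Rational.Properties as ℚ
open import Data.Rational.Solver using (module +-*-Solver)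
open import Data.Rational.Unnormalised.Base as ℚᵘ using (mkℚᵘ; *≡*)
import Data.Rational.Unnormalised.Properties as ℚᵘ
open import Data.Sum.Base using (inj₁; inj₂)
open import Function.Base using (_∘_)
open import Relation.Binary.PropositionalEquality as ≡ using (_≡_; cong; cong₂)
import Relation.Binary.Reasoning.Setoid as SetoidReasoning

-- Formal power series over a commutative ring.

module SeriesProperties {c ℓ} (R : CommutativeRing c ℓ) where

  open CommutativeRing R
  open Series R
  open SemiringSum semiring
  open SetoidReasoning setoid
  open CommutativeSemigroupProperties +-commutativeSemigroup
    using () renaming (x∙yz≈y∙xz to x+[y+z]≈y+[x+z])
  open CommutativeSemigroupProperties *-commutativeSemigroup
    using () renaming (x∙yz≈y∙xz to x*[y*z]≈y*[x*z])

  infix  4 _≈ˢ_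
  infixl 6 _+ˢ_
  infixr 7 _⋆_

  _≈ˢ_ : PowerSeries → PowerSeries → Set ℓ
  f ≈ˢ g = ∀ n → f n ≈ g n

  _+ˢ_ : PowerSeries → PowerSeries → PowerSeries
  (f +ˢ g) n = f n + g n

  _⋆_ : Carrier → PowerSeries → PowerSeries
  (a ⋆ f) n = a * f n

  zeroˢ : PowerSeries
  zeroˢ _ = 0#

  tail : PowerSeries → PowerSeries
  tail f n = f (suc n)

  sum-≈0 : ∀ {n} {a : ℕ → Carrier} → (∀ i → i ≤ n → a i ≈ 0#) → ∑[ i ≤ n ] a (toℕ i) ≈ 0#
  sum-≈0 {n} a≈0 =
    trans (sum-cong-≋ {suc n} λ i → a≈0 (toℕ i) (ℕ.s≤s⁻¹ (Fin.toℕ<n i))) (sum-replicate-zero (suc n))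

  -- Lets cutoffs that vary with an outer index be raised to one common bound before two sums are
  -- exchanged.
  sum-truncate : ∀ {n N} {a : ℕ → Carrier} → n ≤ N → (∀ i → n < i → a i ≈ 0#) →
                 ∑[ i ≤ N ] a (toℕ i) ≈ ∑[ i ≤ n ] a (toℕ i)
  sum-truncate {N = zero}  z≤n       a≈0 = refl
  sum-truncate {N = suc N} {a} z≤n   a≈0 =
    +-congˡ (sum-≈0 {N} {a ∘ suc} λ i _ → a≈0 (suc i) (s≤s z≤n))
  sum-truncate {a = a} (s≤s n≤N) a≈0 =
    +-congˡ (sum-truncate {a = a ∘ suc} n≤N λ i n<i → a≈0 (suc i) (s≤s n<i))

  -- The Cauchy product.

  ·-cong : ∀ {f f′ g g′} → f ≈ˢ f′ → g ≈ˢ g′ → f · g ≈ˢ f′ · g′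
  ·-cong f≈f′ g≈g′ n =
    sum-cong-≋ {suc n} λ i → *-cong (f≈f′ (toℕ i)) (g≈g′ (n ∸ toℕ i))

  ·-distribʳ-+ˢ : ∀ f g h → (g +ˢ h) · f ≈ˢ g · f +ˢ h · f
  ·-distribʳ-+ˢ f g h n = trans
    (sum-cong-≋ {suc n} λ i → distribʳ (f (n ∸ toℕ i)) (g (toℕ i)) (h (toℕ i)))
    (∑-distrib-+ {suc n} (λ i → g (toℕ i) * f (n ∸ toℕ i)) (λ i → h (toℕ i) * f (n ∸ toℕ i)))

  ⋆-·-assoc : ∀ a f g → (a ⋆ f) · g ≈ˢ a ⋆ (f · g)
  ⋆-·-assoc a f g n = trans
    (sum-cong-≋ {suc n} λ i → *-assoc a (f (toℕ i)) (g (n ∸ toℕ i)))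
    (sym (*-distribˡ-sum {suc n} a λ i → f (toℕ i) * g (n ∸ toℕ i)))

  ·-zeroˡ : ∀ f → zeroˢ · f ≈ˢ zeroˢ
  ·-zeroˡ f n = sum-≈0 {n} λ i _ → zeroˡ (f (n ∸ i))

  -- Unfolding f · g at suc n gives f 0 * g (suc n) + (tail f · g) n definitionally;
  -- this is the mirror image.
  ·-suc : ∀ f g n → (f · g) (suc n) ≈ f (suc n) * g 0 + (f · tail g) n
  ·-suc f g zero    = x+[y+z]≈y+[x+z] _ _ _
  ·-suc f g (suc n) = trans (+-congˡ (·-suc (tail f) g n)) (x+[y+z]≈y+[x+z] _ _ _)

  -- Induction on the degree: the first term of `f · g`, peeled off by definition, matches the last
  -- term of `g · f`, peeled off by `·-suc`.
  ·-comm : ∀ f g → f · g ≈ˢ g · f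
  ·-comm f g zero    = +-congʳ (*-comm _ _)
  ·-comm f g (suc n) =
    trans (+-cong (*-comm _ _) (·-comm (tail f) g n)) (sym (·-suc g f n))

  -- Induction on the degree for all `f` at once: by definition `tail (f · g)` is
  -- `f 0 ⋆ tail g +ˢ tail f · g`, so the induction hypothesis is needed at `tail f`.
  ·-assoc : ∀ f g h → (f · g) · h ≈ˢ f · (g · h)
  ·-assoc f g h zero = +-congʳ (begin
    (f 0 * g 0 + 0#) * h 0  ≈⟨ *-congʳ (+-identityʳ _) ⟩
    (f 0 * g 0) * h 0       ≈⟨ *-assoc _ _ _ ⟩
    f 0 * (g 0 * h 0)       ≈⟨ *-congˡ (+-identityʳ _) ⟨
    f 0 * (g 0 * h 0 + 0#)  ∎)
  ·-assoc f g h (suc n) = begin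
    (f 0 * g 0 + 0#) * h (suc n) + (tail (f · g) · h) n
      ≈⟨ +-cong (trans (*-congʳ (+-identityʳ _)) (*-assoc _ _ _))
                (·-distribʳ-+ˢ h (f 0 ⋆ tail g) (tail f · g) n) ⟩
    f 0 * (g 0 * h (suc n)) + (((f 0 ⋆ tail g) · h) n + ((tail f · g) · h) n)
      ≈⟨ +-congˡ (+-cong (⋆-·-assoc (f 0) (tail g) h n) (·-assoc (tail f) g h n)) ⟩
    f 0 * (g 0 * h (suc n)) + (f 0 * (tail g · h) n + (tail f · (g · h)) n)
      ≈⟨ +-assoc _ _ _ ⟨
    f 0 * (g 0 * h (suc n)) + f 0 * (tail g · h) n + (tail f · (g · h)) n
      ≈⟨ +-congʳ (distribˡ _ _ _) ⟨
    f 0 * (g · h) (suc n) + (tail f · (g · h)) n ∎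

  ·-identityˡ : ∀ f → one · f ≈ˢ f
  ·-identityˡ f zero    = trans (+-identityʳ _) (*-identityˡ _)
  ·-identityˡ f (suc n) =
    trans (+-cong (*-identityˡ _) (·-zeroˡ f n)) (+-identityʳ _)

  -- Packaged as a ring so that general ring and semigroup identities apply to whole series.
  seriesRing : CommutativeRing c ℓ
  seriesRing = record
    { Carrier = PowerSeries
    ; _≈_ = _≈ˢ_ ; _+_ = _+ˢ_ ; _*_ = _·_
    ; -_ = λ f n → - f n ; 0# = zeroˢ ; 1# = one
    ; isCommutativeRing = record
      { isRing = record
        { +-isAbelianGroup = Pointwise.isAbelianGroup ℕ +-isAbelianGroup
        ; *-cong = ·-cong
        ; *-assoc = ·-assoc
        ; *-identity = ·-identityˡ , λ f n → trans (·-comm f one n) (·-identityˡ f n)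
        ; distrib =
            (λ f g h n → trans (·-comm f (g +ˢ h) n)
              (trans (·-distribʳ-+ˢ f g h n) (+-cong (·-comm g f n) (·-comm h f n))))
            , ·-distribʳ-+ˢ
        }
      ; *-comm = ·-comm
      }
    }

  -- Substitution of a series with zero constant term.

  ·-zeroAt0 : ∀ g f → g 0 ≈ 0# → (g · f) 0 ≈ 0#
  ·-zeroAt0 g f g0≈0 = trans (+-identityʳ _) (trans (*-congʳ g0≈0) (zeroˡ _))

  ·-tail : ∀ g f → g 0 ≈ 0# → tail (g · f) ≈ˢ tail g · f
  ·-tail g f g0≈0 n =
    trans (+-congʳ (trans (*-congʳ g0≈0) (zeroˡ _))) (+-identityˡ _)

  -- A factor without constant term shifts degrees up, so coefficient `n` of the product sees the
  -- other factor only below `n`. This is what makes the recursion in `chainRule` descend.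
  ·-guarded : ∀ g f f′ n → g 0 ≈ 0# → (∀ {i} → i < n → f i ≈ f′ i) →
              (g · f) n ≈ (g · f′) n
  ·-guarded g f f′ zero g0≈0 f≈f′ =
    trans (·-zeroAt0 g f g0≈0) (sym (·-zeroAt0 g f′ g0≈0))
  ·-guarded g f f′ (suc n) g0≈0 f≈f′ = begin
    (g · f) (suc n)    ≈⟨ ·-tail g f g0≈0 n ⟩
    (tail g · f) n     ≈⟨ sum-cong-≋ {suc n} (λ i → *-congˡ {g (suc (toℕ i))}
                            (f≈f′ (s≤s (ℕ.m∸n≤m n (toℕ i))))) ⟩
    (tail g · f′) n    ≈⟨ ·-tail g f′ g0≈0 n ⟨
    (g · f′) (suc n)   ∎

  -- Each of the `m` factors contributes at least one power of t.
  ^ˢ-vanish : ∀ g {n} m → g 0 ≈ 0# → n < m → (g ^ˢ m) n ≈ 0#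
  ^ˢ-vanish g {zero}  (suc m) g0≈0 _         = ·-zeroAt0 g (g ^ˢ m) g0≈0
  ^ˢ-vanish g {suc n} (suc m) g0≈0 (s≤s n<m) = trans (·-tail g (g ^ˢ m) g0≈0 n)
    (sum-≈0 {n} λ i _ → trans
      (*-congˡ {g (suc i)} (^ˢ-vanish g m g0≈0 (ℕ.≤-<-trans (ℕ.m∸n≤m n i) n<m)))
      (zeroʳ _))

  -- Multiplication distributes over the formally infinite sum of all f(m) gᵐ; the work lies in
  -- exchanging two finite sums whose cutoffs do not agree at first.
  ·-compose : ∀ k f g → g 0 ≈ 0# → ∀ n →
              (k · compose f g) n ≈ ∑[ m ≤ n ] (f (toℕ m) * (k · (g ^ˢ toℕ m)) n)
  ·-compose k f g g0≈0 n = begin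
    ∑[ i ≤ n ] (k (toℕ i) * compose f g (n ∸ toℕ i))
      -- Read from right to left, the inner cutoff `n ∸ i` is raised to `n`, which adds only zero
      -- terms and makes the double sum rectangular.
      ≈⟨ sum-cong-≋ {suc n} (λ i → *-congˡ {k (toℕ i)}
           (sum-truncate {a = λ m → f m * (g ^ˢ m) (n ∸ toℕ i)} (ℕ.m∸n≤m n (toℕ i))
             λ m lt → trans (*-congˡ {f m} (^ˢ-vanish g m g0≈0 lt)) (zeroʳ (f m)))) ⟨
    ∑[ i ≤ n ] (k (toℕ i) * ∑[ m ≤ n ] (f (toℕ m) * (g ^ˢ toℕ m) (n ∸ toℕ i)))
      ≈⟨ sum-cong-≋ {suc n} (λ i → *-distribˡ-sum {suc n} (k (toℕ i))
           λ m → f (toℕ m) * (g ^ˢ toℕ m) (n ∸ toℕ i)) ⟩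
    ∑[ i ≤ n ] ∑[ m ≤ n ] (k (toℕ i) * (f (toℕ m) * (g ^ˢ toℕ m) (n ∸ toℕ i)))
      ≈⟨ ∑-comm {suc n} {suc n} (λ i m → k (toℕ i) * (f (toℕ m) * (g ^ˢ toℕ m) (n ∸ toℕ i))) ⟩
    ∑[ m ≤ n ] ∑[ i ≤ n ] (k (toℕ i) * (f (toℕ m) * (g ^ˢ toℕ m) (n ∸ toℕ i)))
      ≈⟨ sum-cong-≋ {suc n} (λ m → sum-cong-≋ {suc n} λ i →
           x*[y*z]≈y*[x*z] (k (toℕ i)) (f (toℕ m)) ((g ^ˢ toℕ m) (n ∸ toℕ i))) ⟩
    ∑[ m ≤ n ] ∑[ i ≤ n ] (f (toℕ m) * (k (toℕ i) * (g ^ˢ toℕ m) (n ∸ toℕ i)))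
      ≈⟨ sum-cong-≋ {suc n} (λ m → *-distribˡ-sum {suc n} (f (toℕ m))
           λ i → k (toℕ i) * (g ^ˢ toℕ m) (n ∸ toℕ i)) ⟨
    ∑[ m ≤ n ] (f (toℕ m) * (k · (g ^ˢ toℕ m)) n) ∎

  -- Horner's rule: g is substituted into f = f(0) + t · `tail f`. All later reasoning about
  -- composition by recursion goes through this.
  compose-unfold : ∀ f g → g 0 ≈ 0# →
                   compose f g ≈ˢ f 0 ⋆ one +ˢ g · compose (tail f) g
  compose-unfold f g g0≈0 zero    =
    +-congˡ (sym (·-zeroAt0 g (compose (tail f) g) g0≈0))
  compose-unfold f g g0≈0 (suc n) = +-congˡ (begin
    ∑[ m ≤ n ] (f (suc (toℕ m)) * (g · (g ^ˢ toℕ m)) (suc n))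
      ≈⟨ sum-cong-≋ {suc n} (λ m →
           *-congˡ {f (suc (toℕ m))} (·-tail g (g ^ˢ toℕ m) g0≈0 n)) ⟩
    ∑[ m ≤ n ] (f (suc (toℕ m)) * (tail g · (g ^ˢ toℕ m)) n)
      ≈⟨ ·-compose (tail g) (tail f) g g0≈0 n ⟨
    (tail g · compose (tail f) g) n
      ≈⟨ ·-tail g (compose (tail f) g) g0≈0 n ⟨
    (g · compose (tail f) g) (suc n) ∎)

  compose-congˡ : ∀ {f f′} g → f ≈ˢ f′ → compose f g ≈ˢ compose f′ g
  compose-congˡ g f≈f′ n =
    sum-cong-≋ {suc n} λ m → *-congʳ {(g ^ˢ toℕ m) n} (f≈f′ (toℕ m))

  compose-+ˢ : ∀ f f′ g → compose (f +ˢ f′) g ≈ˢ compose f g +ˢ compose f′ g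
  compose-+ˢ f f′ g n = trans
    (sum-cong-≋ {suc n} λ m → distribʳ ((g ^ˢ toℕ m) n) (f (toℕ m)) (f′ (toℕ m)))
    (∑-distrib-+ {suc n} (λ m → f (toℕ m) * (g ^ˢ toℕ m) n) (λ m → f′ (toℕ m) * (g ^ˢ toℕ m) n))

  -- The constant sequence 1 is its own tail, so unfolding G = Σ hᵐ once gives G = 1 + h · G.
  geometric : ∀ h → h 0 ≈ 0# → (one -ˢ h) · compose (λ _ → 1#) h ≈ˢ one
  geometric h h0≈0 = S.begin
    (one -ˢ h) · G                S.≈⟨ [y-z]x≈yx-zx G one h ⟩
    one · G -ˢ h · G              S.≈⟨ S.+-congʳ (S.trans (·-identityˡ G) (compose-unfold (λ _ → 1#) h h0≈0)) ⟩
    (1# ⋆ one +ˢ h · G) -ˢ h · G  S.≈⟨ S.+-assoc (1# ⋆ one) (h · G) (λ n → - (h · G) n) ⟩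
    1# ⋆ one +ˢ (h · G -ˢ h · G)  S.≈⟨ S.+-cong (λ n → *-identityˡ (one n)) (S.-‿inverseʳ (h · G)) ⟩
    one +ˢ zeroˢ                  S.≈⟨ S.+-identityʳ one ⟩
    one                           S.∎
    where
    module S where
      open CommutativeRing seriesRing public
      open SetoidReasoning (CommutativeRing.setoid seriesRing) public
    open RingProperties S.ring using ([y-z]x≈yx-zx)
    G = compose (λ _ → 1#) h

module ℚ[[t]] where
  open Series ℚ.+-*-commutativeRing public
  open SeriesProperties ℚ.+-*-commutativeRing public
  open CommutativeRing seriesRing public
    using (setoid; ring; *-commutativeSemigroup)
    renaming ( sym to ≈ˢ-sym; trans to ≈ˢ-trans
             ; +-cong to +ˢ-cong; +-congˡ to +ˢ-congˡ; +-congʳ to +ˢ-congʳ; +-assoc to +ˢ-assoc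
             ; *-congˡ to ·-congˡ; *-congʳ to ·-congʳ; *-identityʳ to ·-identityʳ
             ; distribˡ to ·-distribˡ-+ˢ)

open ℚ[[t]]

open import Algebra.Definitions.RawSemiring ℚ.+-*-rawSemiring using (_^_)
open CommutativeSemigroupProperties (CommutativeRing.*-commutativeSemigroup ℚ.+-*-commutativeRing)
  using () renaming (interchange to *-interchange; x∙yz≈y∙xz to x*[y*z]≡y*[x*z])

-- The embedding of the natural numbers in ℚ.

fromℕ-homo-+ : ∀ m n → fromℕ (m ℕ.+ n) ≡ fromℕ m ℚ.+ fromℕ n
-- Since `_/_` reduces to lowest terms, the identity is moved to unnormalised fractions, where it is
-- a cross-multiplied equation between integers.
fromℕ-homo-+ m n = ℚ.toℚᵘ-injective (begin
  toℚᵘ (fromℕ (m ℕ.+ n))                ≈⟨ ℚ.toℚᵘ-fromℚᵘ (mkℚᵘ (+ (m ℕ.+ n)) 0) ⟩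
  mkℚᵘ (+ (m ℕ.+ n)) 0
    ≈⟨ *≡* (cong (ℤ._* + 1) (cong₂ ℤ._+_ (≡.sym (ℤ.*-identityʳ (+ m))) (≡.sym (ℤ.*-identityʳ (+ n))))) ⟩
  mkℚᵘ (+ m) 0 ℚᵘ.+ mkℚᵘ (+ n) 0
    ≈⟨ ℚᵘ.+-cong (ℚ.toℚᵘ-fromℚᵘ (mkℚᵘ (+ m) 0)) (ℚ.toℚᵘ-fromℚᵘ (mkℚᵘ (+ n) 0)) ⟨
  toℚᵘ (fromℕ m) ℚᵘ.+ toℚᵘ (fromℕ n)    ≈⟨ ℚ.toℚᵘ-homo-+ (fromℕ m) (fromℕ n) ⟨
  toℚᵘ (fromℕ m ℚ.+ fromℕ n)            ∎)
  where open SetoidReasoning ℚᵘ.≃-setoid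

fromℕ-homo-* : ∀ m n → fromℕ (m ℕ.* n) ≡ fromℕ m ℚ.* fromℕ n
fromℕ-homo-* m n = ℚ.toℚᵘ-injective (begin
  toℚᵘ (fromℕ (m ℕ.* n))                ≈⟨ ℚ.toℚᵘ-fromℚᵘ (mkℚᵘ (+ (m ℕ.* n)) 0) ⟩
  mkℚᵘ (+ (m ℕ.* n)) 0                  ≈⟨ *≡* (cong (ℤ._* + 1) (ℤ.pos-* m n)) ⟩
  mkℚᵘ (+ m) 0 ℚᵘ.* mkℚᵘ (+ n) 0
    ≈⟨ ℚᵘ.*-cong (ℚ.toℚᵘ-fromℚᵘ (mkℚᵘ (+ m) 0)) (ℚ.toℚᵘ-fromℚᵘ (mkℚᵘ (+ n) 0)) ⟨
  toℚᵘ (fromℕ m) ℚᵘ.* toℚᵘ (fromℕ n)    ≈⟨ ℚ.toℚᵘ-homo-* (fromℕ m) (fromℕ n) ⟨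
  toℚᵘ (fromℕ m ℚ.* fromℕ n)            ∎)
  where open SetoidReasoning ℚᵘ.≃-setoid

fromℕ-inverseʳ : ∀ n .{{_ : ℕ.NonZero n}} → fromℕ n ℚ.* (+ 1 / n) ≡ 1ℚ
fromℕ-inverseʳ n@(suc n-1) = ℚ.toℚᵘ-injective (begin
  toℚᵘ (fromℕ n ℚ.* (+ 1 / n))          ≈⟨ ℚ.toℚᵘ-homo-* (fromℕ n) (+ 1 / n) ⟩
  toℚᵘ (fromℕ n) ℚᵘ.* toℚᵘ (+ 1 / n)
    ≈⟨ ℚᵘ.*-cong (ℚ.toℚᵘ-fromℚᵘ (mkℚᵘ (+ n) 0)) (ℚ.toℚᵘ-fromℚᵘ (mkℚᵘ (+ 1) n-1)) ⟩
  mkℚᵘ (+ n) 0 ℚᵘ.* mkℚᵘ (+ 1) n-1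
    ≈⟨ *≡* (≡.trans (ℤ.*-identityʳ (+ n ℤ.* + 1)) (≡.trans (ℤ.*-comm (+ n) (+ 1))
         (cong (λ k → + 1 ℤ.* + k) (≡.sym (ℕ.*-identityˡ n))))) ⟩
  mkℚᵘ (+ 1) 0                          ∎)
  where open SetoidReasoning ℚᵘ.≃-setoid

-- Formal differentiation.

∂ : PowerSeries → PowerSeries
∂ f n = fromℕ (suc n) ℚ.* f (suc n)

-- t·d/dt, whose product rule needs no index shift; ∂ is its tail.
θ : PowerSeries → PowerSeries
θ f n = fromℕ n ℚ.* f n

-- In each term of the Cauchy product the weight splits as n = i + (n - i), one summand for each
-- factor.
θ-· : ∀ f g → θ (f · g) ≈ˢ θ f · g +ˢ f · θ g
θ-· f g n = begin
  fromℕ n * (f · g) n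
    ≈⟨ *-distribˡ-sum {suc n} (fromℕ n) (λ i → f (toℕ i) * g (n ∸ toℕ i)) ⟩
  ∑[ i ≤ n ] (fromℕ n * (f (toℕ i) * g (n ∸ toℕ i)))
    ≈⟨ sum-cong-≋ {suc n} (λ i → term (toℕ i) (ℕ.s≤s⁻¹ (Fin.toℕ<n i))) ⟩
  ∑[ i ≤ n ] (θ f (toℕ i) * g (n ∸ toℕ i) + f (toℕ i) * θ g (n ∸ toℕ i))
    ≈⟨ ∑-distrib-+ {suc n} (λ i → θ f (toℕ i) * g (n ∸ toℕ i)) (λ i → f (toℕ i) * θ g (n ∸ toℕ i)) ⟩
  (θ f · g) n + (f · θ g) n ∎
  where
  open CommutativeRing ℚ.+-*-commutativeRing using (semiring; _+_; _*_)
    renaming (setoid to ℚ-setoid)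
  open SetoidReasoning ℚ-setoid
  open SemiringSum semiring
  term : ∀ i → i ≤ n → fromℕ n * (f i * g (n ∸ i)) ≡ θ f i * g (n ∸ i) + f i * θ g (n ∸ i)
  term i i≤n = begin
    fromℕ n * (f i * g (n ∸ i))
      ≡⟨ cong (λ k → fromℕ k * (f i * g (n ∸ i))) (ℕ.m+[n∸m]≡n i≤n) ⟨
    fromℕ (i ℕ.+ (n ∸ i)) * (f i * g (n ∸ i))
      ≡⟨ cong (_* (f i * g (n ∸ i))) (fromℕ-homo-+ i (n ∸ i)) ⟩
    (fromℕ i + fromℕ (n ∸ i)) * (f i * g (n ∸ i))
      ≡⟨ ℚ.*-distribʳ-+ (f i * g (n ∸ i)) (fromℕ i) (fromℕ (n ∸ i)) ⟩
    fromℕ i * (f i * g (n ∸ i)) + fromℕ (n ∸ i) * (f i * g (n ∸ i))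
      ≡⟨ cong₂ _+_ (≡.sym (ℚ.*-assoc (fromℕ i) (f i) (g (n ∸ i))))
                   (x*[y*z]≡y*[x*z] (fromℕ (n ∸ i)) (f i) (g (n ∸ i))) ⟩
    θ f i * g (n ∸ i) + f i * θ g (n ∸ i) ∎

-- This is the rule for `θ` one degree higher: `θ f` and `θ g` have no constant term, so `·-tail`
-- strips one t once they stand on the left.
∂-· : ∀ f g → ∂ (f · g) ≈ˢ ∂ f · g +ˢ f · ∂ g
∂-· f g n = begin
  θ (f · g) (suc n)                         ≡⟨ θ-· f g (suc n) ⟩
  (θ f · g) (suc n) ℚ.+ (f · θ g) (suc n)   ≡⟨ cong ((θ f · g) (suc n) ℚ.+_) (·-comm f (θ g) (suc n)) ⟩
  (θ f · g) (suc n) ℚ.+ (θ g · f) (suc n)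
    ≡⟨ cong₂ ℚ._+_ (·-tail (θ f) g (ℚ.*-zeroˡ (f 0)) n) (·-tail (θ g) f (ℚ.*-zeroˡ (g 0)) n) ⟩
  (∂ f · g) n ℚ.+ (∂ g · f) n               ≡⟨ cong ((∂ f · g) n ℚ.+_) (·-comm (∂ g) f n) ⟩
  (∂ f · g) n ℚ.+ (f · ∂ g) n               ∎
  where open ≡.≡-Reasoning

∂-cong : ∀ {f g} → f ≈ˢ g → ∂ f ≈ˢ ∂ g
∂-cong f≈g n = cong (fromℕ (suc n) ℚ.*_) (f≈g (suc n))

∂-+ˢ : ∀ f g → ∂ (f +ˢ g) ≈ˢ ∂ f +ˢ ∂ g
∂-+ˢ f g n = ℚ.*-distribˡ-+ (fromℕ (suc n)) (f (suc n)) (g (suc n))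

∂-constant : ∀ a → ∂ (a ⋆ one) ≈ˢ zeroˢ
∂-constant a n =
  ≡.trans (cong (fromℕ (suc n) ℚ.*_) (ℚ.*-zeroʳ a)) (ℚ.*-zeroʳ (fromℕ (suc n)))

1/suc*fromℕ-cancel : ∀ n x → (+ 1 / suc n) ℚ.* (fromℕ (suc n) ℚ.* x) ≡ x
1/suc*fromℕ-cancel n x = begin
  (+ 1 / suc n) ℚ.* (fromℕ (suc n) ℚ.* x)
    ≡⟨ ℚ.*-assoc (+ 1 / suc n) (fromℕ (suc n)) x ⟨
  (+ 1 / suc n) ℚ.* fromℕ (suc n) ℚ.* x
    ≡⟨ cong (ℚ._* x) (≡.trans (ℚ.*-comm (+ 1 / suc n) (fromℕ (suc n))) (fromℕ-inverseʳ (suc n))) ⟩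
  1ℚ ℚ.* x
    ≡⟨ ℚ.*-identityˡ x ⟩
  x ∎
  where open ≡.≡-Reasoning

-- Over ℚ the factor n + 1 can be divided out. This is how identities between series are proved
-- below: compare constant terms, then derivatives.
∂-injective : ∀ f g → f 0 ≡ g 0 → ∂ f ≈ˢ ∂ g → f ≈ˢ g
∂-injective f g f0≡g0 ∂f≈∂g zero    = f0≡g0
∂-injective f g f0≡g0 ∂f≈∂g (suc n) = begin
  f (suc n)                    ≡⟨ 1/suc*fromℕ-cancel n (f (suc n)) ⟨
  (+ 1 / suc n) ℚ.* ∂ f n      ≡⟨ cong ((+ 1 / suc n) ℚ.*_) (∂f≈∂g n) ⟩
  (+ 1 / suc n) ℚ.* ∂ g n      ≡⟨ 1/suc*fromℕ-cancel n (g (suc n)) ⟩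
  g (suc n)                    ∎
  where open ≡.≡-Reasoning

-- The chain rule.

tail-∂ : ∀ f → tail (∂ f) ≈ˢ tail (tail f) +ˢ ∂ (tail f)
tail-∂ f n = begin
  fromℕ (suc (suc n)) ℚ.* x                 ≡⟨ cong (ℚ._* x) (fromℕ-homo-+ 1 (suc n)) ⟩
  (1ℚ ℚ.+ fromℕ (suc n)) ℚ.* x              ≡⟨ ℚ.*-distribʳ-+ x 1ℚ (fromℕ (suc n)) ⟩
  1ℚ ℚ.* x ℚ.+ fromℕ (suc n) ℚ.* x          ≡⟨ cong (ℚ._+ fromℕ (suc n) ℚ.* x) (ℚ.*-identityˡ x) ⟩
  x ℚ.+ fromℕ (suc n) ℚ.* x                 ∎
  where
  open ≡.≡-Reasoning
  x = f (suc (suc n))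

-- With h = `tail f`, differentiating f = f(0) + t h gives f′ = h + t h′; here g is substituted for
-- t in that identity.
compose-∂ : ∀ f g → g 0 ≡ 0ℚ →
            compose (∂ f) g ≈ˢ compose (tail f) g +ˢ g · compose (∂ (tail f)) g
compose-∂ f g g0≡0 = begin
  compose (∂ f) g
    ≈⟨ compose-unfold (∂ f) g g0≡0 ⟩
  ∂ f 0 ⋆ one +ˢ g · compose (tail (∂ f)) g
    ≈⟨ +ˢ-cong (λ n → cong (ℚ._* one n) (ℚ.*-identityˡ (f 1)))
               (·-congˡ {g} (≈ˢ-trans (compose-congˡ g (tail-∂ f))
                                      (compose-+ˢ (tail (tail f)) (∂ (tail f)) g))) ⟩
  f 1 ⋆ one +ˢ g · (compose (tail (tail f)) g +ˢ compose (∂ (tail f)) g)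
    ≈⟨ +ˢ-congˡ {f 1 ⋆ one} (·-distribˡ-+ˢ g (compose (tail (tail f)) g) (compose (∂ (tail f)) g)) ⟩
  f 1 ⋆ one +ˢ (g · compose (tail (tail f)) g +ˢ g · compose (∂ (tail f)) g)
    ≈⟨ +ˢ-assoc (f 1 ⋆ one) (g · compose (tail (tail f)) g) (g · compose (∂ (tail f)) g) ⟨
  f 1 ⋆ one +ˢ g · compose (tail (tail f)) g +ˢ g · compose (∂ (tail f)) g
    ≈⟨ +ˢ-congʳ {g · compose (∂ (tail f)) g} (compose-unfold (tail f) g g0≡0) ⟨
  compose (tail f) g +ˢ g · compose (∂ (tail f)) g ∎
  where open SetoidReasoning setoid

-- Unfolding compose f g = f 0 + g · compose (tail f) g reduces the n-th coefficient to
-- smaller ones, as multiplication by g shifts degrees up.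
mutual
  chainRule : ∀ f g → g 0 ≡ 0ℚ → ∂ (compose f g) ≈ˢ compose (∂ f) g · ∂ g
  chainRule f g g0≡0 n = begin
    ∂ (compose f g) n
      ≡⟨ ∂-cong (compose-unfold f g g0≡0) n ⟩
    ∂ (f 0 ⋆ one +ˢ g · K) n
      ≡⟨ ∂-+ˢ (f 0 ⋆ one) (g · K) n ⟩
    ∂ (f 0 ⋆ one) n ℚ.+ ∂ (g · K) n
      ≡⟨ cong₂ ℚ._+_ (∂-constant (f 0) n) (∂-· g K n) ⟩
    0ℚ ℚ.+ ((∂ g · K) n ℚ.+ (g · ∂ K) n)
      ≡⟨ ℚ.+-identityˡ _ ⟩
    (∂ g · K) n ℚ.+ (g · ∂ K) n
      ≡⟨ cong ((∂ g · K) n ℚ.+_) (·-guarded g (∂ K) (K′ · ∂ g) n g0≡0 (chainRule-< n (tail f) g g0≡0)) ⟩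
    (∂ g · K) n ℚ.+ (g · (K′ · ∂ g)) n
      ≡⟨ cong₂ ℚ._+_ (·-comm (∂ g) K n) (≡.sym (·-assoc g K′ (∂ g) n)) ⟩
    (K · ∂ g) n ℚ.+ ((g · K′) · ∂ g) n
      ≡⟨ ·-distribʳ-+ˢ (∂ g) K (g · K′) n ⟨
    ((K +ˢ g · K′) · ∂ g) n
      ≡⟨ ·-congʳ {∂ g} (compose-∂ f g g0≡0) n ⟨
    (compose (∂ f) g · ∂ g) n ∎
    where
    open ≡.≡-Reasoning
    K  = compose (tail f) g
    K′ = compose (∂ (tail f)) g

  -- The bound is a separate argument so that strong induction becomes structural: `chainRule` is
  -- called only after a `suc` has been removed from it.
  chainRule-< : ∀ n f g → g 0 ≡ 0ℚ → ∀ {i} → i < n →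
                ∂ (compose f g) i ≡ (compose (∂ f) g · ∂ g) i
  chainRule-< (suc n) f g g0≡0 {i} i<n with ℕ.m≤n⇒m<n∨m≡n (ℕ.s≤s⁻¹ i<n)
  ... | inj₁ i<n′   = chainRule-< n f g g0≡0 i<n′
  ... | inj₂ ≡.refl = chainRule f g g0≡0 n

-- Reciprocals.

f-[f-g]≈g : ∀ f g → f -ˢ (f -ˢ g) ≈ˢ g
f-[f-g]≈g f g n = begin
  f n ℚ.- (f n ℚ.- g n)             ≡⟨ cong (f n ℚ.+_) (ℚ.neg-distrib-+ (f n) (ℚ.- g n)) ⟩
  f n ℚ.+ (ℚ.- f n ℚ.+ ℚ.- ℚ.- g n) ≡⟨ ℚ.+-assoc (f n) (ℚ.- f n) (ℚ.- ℚ.- g n) ⟨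
  f n ℚ.- f n ℚ.+ ℚ.- ℚ.- g n       ≡⟨ cong₂ ℚ._+_ (ℚ.+-inverseʳ (f n)) (-‿involutive (g n)) ⟩
  0ℚ ℚ.+ g n                        ≡⟨ ℚ.+-identityˡ (g n) ⟩
  g n                               ∎
  where
  open ≡.≡-Reasoning
  open RingProperties ℚ.+-*-ring using (-‿involutive)

-- The scalar `a` moves from the geometric series onto `g`. Then `a ⋆ g` is 1 - h, and h has no
-- constant term because `a` inverts `g 0`, so `geometric` applies.
·-inverseʳ : ∀ g .{{_ : ℚ.NonZero (g 0)}} → g · inverse g ≈ˢ one
·-inverseʳ g = begin
  g · (a ⋆ G)         ≈⟨ ·-comm g (a ⋆ G) ⟩
  (a ⋆ G) · g         ≈⟨ ⋆-·-assoc a G g ⟩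
  a ⋆ (G · g)         ≈⟨ (λ n → cong (a ℚ.*_) (·-comm G g n)) ⟩
  a ⋆ (g · G)         ≈⟨ ⋆-·-assoc a g G ⟨
  (a ⋆ g) · G         ≈⟨ ·-congʳ {G} (f-[f-g]≈g one (a ⋆ g)) ⟨
  (one -ˢ h) · G      ≈⟨ geometric h h0≡0 ⟩
  one                 ∎
  where
  open SetoidReasoning setoid
  a = ℚ.1/ g 0
  h = one -ˢ a ⋆ g
  G = compose (λ _ → 1ℚ) h
  h0≡0 : h 0 ≡ 0ℚ
  h0≡0 = cong (λ x → 1ℚ ℚ.- x) (ℚ.*-inverseˡ (g 0))

·-inverse-unique : ∀ f g .{{_ : ℚ.NonZero (g 0)}} → g · f ≈ˢ one → f ≈ˢ inverse g
·-inverse-unique f g gf≈1 = begin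
  f                    ≈⟨ ·-identityʳ f ⟨
  f · one              ≈⟨ ·-congˡ {f} (·-inverseʳ g) ⟨
  f · (g · inverse g)  ≈⟨ ·-assoc f g (inverse g) ⟨
  (f · g) · inverse g  ≈⟨ ·-congʳ {inverse g} (≈ˢ-trans (·-comm f g) gf≈1) ⟩
  one · inverse g      ≈⟨ ·-identityˡ (inverse g) ⟩
  inverse g            ∎
  where open SetoidReasoning setoid

-- Exponential series.

fromℕ-suc*1/! : ∀ n → fromℕ (suc n) ℚ.* 1/ suc n ! ≡ 1/ n !
fromℕ-suc*1/! n = begin
  a ℚ.* q                  ≡⟨ ℚ.*-identityʳ (a ℚ.* q) ⟨
  -- The 1 is written as n! · 1/n!, so that n + 1 and n! combine to (n + 1)!, which cancels `q` and
  -- leaves `p`.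
  a ℚ.* q ℚ.* 1ℚ           ≡⟨ cong (a ℚ.* q ℚ.*_) (fromℕ-inverseʳ (n !) {{n ℕ.!≢0}}) ⟨
  a ℚ.* q ℚ.* (b ℚ.* p)    ≡⟨ *-interchange a q b p ⟩
  a ℚ.* b ℚ.* (q ℚ.* p)    ≡⟨ ℚ.*-assoc (a ℚ.* b) q p ⟨
  a ℚ.* b ℚ.* q ℚ.* p      ≡⟨ cong (λ x → x ℚ.* q ℚ.* p) (fromℕ-homo-* (suc n) (n !)) ⟨
  fromℕ (suc n !) ℚ.* q ℚ.* p ≡⟨ cong (ℚ._* p) (fromℕ-inverseʳ (suc n !) {{suc n ℕ.!≢0}}) ⟩
  1ℚ ℚ.* p                 ≡⟨ ℚ.*-identityˡ p ⟩
  p                        ∎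
  where
  open ≡.≡-Reasoning
  a = fromℕ (suc n)
  b = fromℕ (n !)
  p = 1/ n !
  q = 1/ suc n !

∂-exp : ∀ a → ∂ exp[ a ] ≈ˢ a ⋆ exp[ a ]
∂-exp a n = begin
  fromℕ (suc n) ℚ.* (a ^ suc n ℚ.* 1/ suc n !)   ≡⟨ x*[y*z]≡y*[x*z] (fromℕ (suc n)) (a ^ suc n) (1/ suc n !) ⟩
  a ^ suc n ℚ.* (fromℕ (suc n) ℚ.* 1/ suc n !)   ≡⟨ cong (a ^ suc n ℚ.*_) (fromℕ-suc*1/! n) ⟩
  a ^ suc n ℚ.* 1/ n !                           ≡⟨ ℚ.*-assoc a (a ^ n) (1/ n !) ⟩
  a ℚ.* (a ^ n ℚ.* 1/ n !)                       ∎
  where open ≡.≡-Reasoning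

eᵗ e⁻ᵗ 1-e⁻ᵗ eᵗ-1 : PowerSeries
eᵗ    = exp[ 1ℚ ]
e⁻ᵗ   = exp[ ℚ.- 1ℚ ]
1-e⁻ᵗ = one -ˢ e⁻ᵗ
eᵗ-1  = eᵗ -ˢ one

x+-1*x≡0 : ∀ x → x ℚ.+ (ℚ.- 1ℚ) ℚ.* x ≡ 0ℚ
x+-1*x≡0 x = ≡.trans (cong (x ℚ.+_) (-1*x≈-x x)) (ℚ.+-inverseʳ x)
  where open RingProperties ℚ.+-*-ring using (-1*x≈-x)

-- By the product rule the derivative is eᵗe⁻ᵗ - eᵗe⁻ᵗ = 0, and the constant term is 1.
eᵗ·e⁻ᵗ≈1 : eᵗ · e⁻ᵗ ≈ˢ one
eᵗ·e⁻ᵗ≈1 = ∂-injective (eᵗ · e⁻ᵗ) one ≡.refl λ n → begin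
  ∂ (eᵗ · e⁻ᵗ) n
    ≡⟨ ∂-· eᵗ e⁻ᵗ n ⟩
  (∂ eᵗ · e⁻ᵗ) n ℚ.+ (eᵗ · ∂ e⁻ᵗ) n
    ≡⟨ cong₂ ℚ._+_
         (·-congʳ {e⁻ᵗ} (≈ˢ-trans (∂-exp 1ℚ) (ℚ.*-identityˡ ∘ eᵗ)) n)
         (≡.trans (·-comm eᵗ (∂ e⁻ᵗ) n)
           (≡.trans (·-congʳ {eᵗ} (∂-exp (ℚ.- 1ℚ)) n) (⋆-·-assoc (ℚ.- 1ℚ) e⁻ᵗ eᵗ n))) ⟩
  (eᵗ · e⁻ᵗ) n ℚ.+ (ℚ.- 1ℚ) ℚ.* (e⁻ᵗ · eᵗ) n
    ≡⟨ cong (λ x → (eᵗ · e⁻ᵗ) n ℚ.+ (ℚ.- 1ℚ) ℚ.* x) (·-comm e⁻ᵗ eᵗ n) ⟩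
  (eᵗ · e⁻ᵗ) n ℚ.+ (ℚ.- 1ℚ) ℚ.* (eᵗ · e⁻ᵗ) n
    ≡⟨ x+-1*x≡0 ((eᵗ · e⁻ᵗ) n) ⟩
  0ℚ
    ≡⟨ ℚ.*-zeroʳ (fromℕ (suc n)) ⟨
  ∂ one n ∎
  where open ≡.≡-Reasoning

∂[1-e⁻ᵗ]≈e⁻ᵗ : ∂ 1-e⁻ᵗ ≈ˢ e⁻ᵗ
∂[1-e⁻ᵗ]≈e⁻ᵗ n = begin
  fromℕ (suc n) ℚ.* (0ℚ ℚ.- e⁻ᵗ (suc n))
    ≡⟨ cong (fromℕ (suc n) ℚ.*_) (ℚ.+-identityˡ (ℚ.- e⁻ᵗ (suc n))) ⟩
  fromℕ (suc n) ℚ.* ℚ.- e⁻ᵗ (suc n)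
    ≡⟨ ℚ.neg-distribʳ-* (fromℕ (suc n)) (e⁻ᵗ (suc n)) ⟨
  ℚ.- ∂ e⁻ᵗ n
    ≡⟨ cong ℚ.-_ (≡.trans (∂-exp (ℚ.- 1ℚ) n) (-1*x≈-x (e⁻ᵗ n))) ⟩
  ℚ.- ℚ.- e⁻ᵗ n
    ≡⟨ -‿involutive (e⁻ᵗ n) ⟩
  e⁻ᵗ n ∎
  where
  open ≡.≡-Reasoning
  open RingProperties ℚ.+-*-ring using (-1*x≈-x; -‿involutive)

-- Polylogarithms at 1 - e⁻ᵗ.

∂-Li₁ : ∂ (Li (+ 1)) ≈ˢ λ _ → 1ℚ
∂-Li₁ m = ≡.trans (cong (fromℕ (suc m) ℚ.*_) (ℚ.*-identityʳ (+ 1 / suc m))) (fromℕ-inverseʳ (suc m))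

-- The classical relation between x times the derivative and the polylogarithm of index k, with x
-- cancelled; `tail` is that division, as `Li` has no constant term.
∂-Li-suc : ∀ k → ∂ (Li (+ suc k)) ≈ˢ tail (Li (+ k))
∂-Li-suc k m = begin
  fromℕ (suc m) ℚ.* (a ℚ.* a ^ k)  ≡⟨ ℚ.*-assoc (fromℕ (suc m)) a (a ^ k) ⟨
  fromℕ (suc m) ℚ.* a ℚ.* a ^ k    ≡⟨ cong (ℚ._* a ^ k) (fromℕ-inverseʳ (suc m)) ⟩
  1ℚ ℚ.* a ^ k                     ≡⟨ ℚ.*-identityˡ (a ^ k) ⟩
  a ^ k                            ∎
  where
  open ≡.≡-Reasoning
  a = + 1 / suc m

∂T≈1 : ∂ T ≈ˢ one
∂T≈1 zero    = ≡.refl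
∂T≈1 (suc n) = ℚ.*-zeroʳ (fromℕ (suc (suc n)))

Li₁[1-e⁻ᵗ]≈t : compose (Li (+ 1)) 1-e⁻ᵗ ≈ˢ T
Li₁[1-e⁻ᵗ]≈t = ∂-injective (compose (Li (+ 1)) 1-e⁻ᵗ) T ≡.refl (begin
  ∂ (compose (Li (+ 1)) 1-e⁻ᵗ)             ≈⟨ chainRule (Li (+ 1)) 1-e⁻ᵗ ≡.refl ⟩
  compose (∂ (Li (+ 1))) 1-e⁻ᵗ · ∂ 1-e⁻ᵗ
    -- Writing e⁻ᵗ as 1 - (1 - e⁻ᵗ) makes it the denominator of the geometric series in 1 - e⁻ᵗ.
    ≈⟨ ·-cong (compose-congˡ 1-e⁻ᵗ ∂-Li₁)
              (≈ˢ-trans ∂[1-e⁻ᵗ]≈e⁻ᵗ (≈ˢ-sym (f-[f-g]≈g one e⁻ᵗ))) ⟩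
  G · (one -ˢ 1-e⁻ᵗ)                       ≈⟨ ·-comm G (one -ˢ 1-e⁻ᵗ) ⟩
  (one -ˢ 1-e⁻ᵗ) · G                       ≈⟨ geometric 1-e⁻ᵗ ≡.refl ⟩
  one                                      ≈⟨ ∂T≈1 ⟨
  ∂ T                                      ∎)
  where
  open SetoidReasoning setoid
  G = compose (λ _ → 1ℚ) 1-e⁻ᵗ

-- Splits off a factor eᵗ that will cancel the e⁻ᵗ produced by the chain rule.
eᵗ-1≈eᵗ·[1-e⁻ᵗ] : eᵗ-1 ≈ˢ eᵗ · 1-e⁻ᵗ
eᵗ-1≈eᵗ·[1-e⁻ᵗ] = begin
  eᵗ -ˢ one               ≈⟨ (λ n → cong₂ ℚ._-_ (·-identityʳ eᵗ n) (eᵗ·e⁻ᵗ≈1 n)) ⟨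
  eᵗ · one -ˢ eᵗ · e⁻ᵗ    ≈⟨ x[y-z]≈xy-xz eᵗ one e⁻ᵗ ⟨
  eᵗ · 1-e⁻ᵗ              ∎
  where
  open SetoidReasoning setoid
  open RingProperties ring using (x[y-z]≈xy-xz)

[eᵗ-1]·∂Li₂[1-e⁻ᵗ]≈t : eᵗ-1 · ∂ (compose (Li (+ 2)) 1-e⁻ᵗ) ≈ˢ T
[eᵗ-1]·∂Li₂[1-e⁻ᵗ]≈t = begin
  eᵗ-1 · ∂ (compose (Li (+ 2)) 1-e⁻ᵗ)
    ≈⟨ ·-cong eᵗ-1≈eᵗ·[1-e⁻ᵗ] (≈ˢ-trans (chainRule (Li (+ 2)) 1-e⁻ᵗ ≡.refl)
         (·-cong (compose-congˡ 1-e⁻ᵗ (∂-Li-suc 1)) ∂[1-e⁻ᵗ]≈e⁻ᵗ)) ⟩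
  (eᵗ · 1-e⁻ᵗ) · (L · e⁻ᵗ)
    ≈⟨ ·-congˡ {eᵗ · 1-e⁻ᵗ} (·-comm L e⁻ᵗ) ⟩
  (eᵗ · 1-e⁻ᵗ) · (e⁻ᵗ · L)
    -- Regrouping pairs eᵗ with e⁻ᵗ, and 1 - e⁻ᵗ with `L`, which is Li₁(1 - e⁻ᵗ)/(1 - e⁻ᵗ).
    ≈⟨ interchange eᵗ 1-e⁻ᵗ e⁻ᵗ L ⟩
  (eᵗ · e⁻ᵗ) · (1-e⁻ᵗ · L)
    ≈⟨ ·-cong eᵗ·e⁻ᵗ≈1 [1-e⁻ᵗ]·L≈t ⟩
  one · T
    ≈⟨ ·-identityˡ T ⟩
  T ∎
  where
  open SetoidReasoning setoid
  open CommutativeSemigroupProperties *-commutativeSemigroup using (interchange)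
  L = compose (tail (Li (+ 1))) 1-e⁻ᵗ
  [1-e⁻ᵗ]·L≈t : 1-e⁻ᵗ · L ≈ˢ T
  [1-e⁻ᵗ]·L≈t = begin
    1-e⁻ᵗ · L                    ≈⟨ (λ n → ℚ.+-identityˡ ((1-e⁻ᵗ · L) n)) ⟨
    zeroˢ +ˢ 1-e⁻ᵗ · L           ≈⟨ (λ n → cong (ℚ._+ (1-e⁻ᵗ · L) n) (ℚ.*-zeroˡ (one n))) ⟨
    0ℚ ⋆ one +ˢ 1-e⁻ᵗ · L        ≈⟨ compose-unfold (Li (+ 1)) 1-e⁻ᵗ ≡.refl ⟨
    compose (Li (+ 1)) 1-e⁻ᵗ     ≈⟨ Li₁[1-e⁻ᵗ]≈t ⟩
    T                            ∎

-- The derivative of Li₂(1 - e⁻ᵗ) as t/(eᵗ - 1).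

divT[T]≈1 : divT T ≈ˢ one
divT[T]≈1 zero    = ≡.refl
divT[T]≈1 (suc n) = ≡.refl

quotient-T : ∀ g .{{_ : ℚ.NonZero (g 1)}} → quotient T g ≈ˢ inverse (divT g)
quotient-T g = ≈ˢ-trans (·-congʳ {inverse (divT g)} divT[T]≈1) (·-identityˡ (inverse (divT g)))

-- Since eᵗ - 1 is not invertible, one t is cancelled from (eᵗ - 1) F′ = t first; then F′ is the
-- unique reciprocal of (eᵗ - 1)/t.
∂Li₂[1-e⁻ᵗ]≈t/[eᵗ-1] : ∂ (compose (Li (+ 2)) 1-e⁻ᵗ) ≈ˢ quotient T eᵗ-1
∂Li₂[1-e⁻ᵗ]≈t/[eᵗ-1] = ≈ˢ-trans (·-inverse-unique F′ (divT eᵗ-1) (begin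
  divT eᵗ-1 · F′       ≈⟨ ·-tail eᵗ-1 F′ ≡.refl ⟨
  divT (eᵗ-1 · F′)     ≈⟨ [eᵗ-1]·∂Li₂[1-e⁻ᵗ]≈t ∘ suc ⟩
  divT T               ≈⟨ divT[T]≈1 ⟩
  one                  ∎))
  (≈ˢ-sym (quotient-T eᵗ-1))
  where
  open SetoidReasoning setoid
  F′ = ∂ (compose (Li (+ 2)) 1-e⁻ᵗ)

-- Binomial and Bernoulli coefficients.

nCk*[k!*[n∸k]!]≡n! : ∀ {n k} → k ≤ n → (n C k) ℕ.* (k ! ℕ.* (n ∸ k) !) ≡ n !
nCk*[k!*[n∸k]!]≡n! {n} {k} k≤n =
  ≡.trans (cong (ℕ._* (k ! ℕ.* (n ∸ k) !)) (nCk≡n!/k![n-k]! k≤n))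
          (m/n*n≡m {{k ℕ.!* (n ∸ k) !≢0}} (k![n∸k]!∣n! k≤n))

-- Coefficient l of F/t is β/(l + 1), where β is that of F′. Of the factors of n! = C(n,l) l! (n -
-- l)!, l! turns β into the Bernoulli number, and (n - l)! is kept for `bernoulli₂ (n ∸ l) x`.
binomial-bernoulli : ∀ {n l} → l ≤ n →
  fromℕ (n !) ℚ.* divT (compose (Li (+ 2)) 1-e⁻ᵗ) l
    ≡ fromℕ (n C l) ℚ.* bernoulli l ℚ.* (+ 1 / suc l) ℚ.* fromℕ ((n ∸ l) !)
binomial-bernoulli {n} {l} l≤n = begin
  fromℕ (n !) ℚ.* divT F l
    ≡⟨ cong₂ ℚ._*_ n!≡ F≡ ⟩
  (c ℚ.* (p ℚ.* q)) ℚ.* (a ℚ.* β)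
    ≡⟨ solve 5 (λ a c p q β → (c :* (p :* q)) :* (a :* β) := c :* (p :* β) :* a :* q) ≡.refl a c p q β ⟩
  c ℚ.* (p ℚ.* β) ℚ.* a ℚ.* q ∎
  where
  open ≡.≡-Reasoning
  open +-*-Solver
  F = compose (Li (+ 2)) 1-e⁻ᵗ
  a = + 1 / suc l
  c = fromℕ (n C l)
  p = fromℕ (l !)
  q = fromℕ ((n ∸ l) !)
  β = quotient T eᵗ-1 l
  n!≡ : fromℕ (n !) ≡ c ℚ.* (p ℚ.* q)
  n!≡ = begin
    fromℕ (n !)                                  ≡⟨ cong fromℕ (nCk*[k!*[n∸k]!]≡n! l≤n) ⟨
    fromℕ ((n C l) ℕ.* (l ! ℕ.* (n ∸ l) !))      ≡⟨ fromℕ-homo-* (n C l) (l ! ℕ.* (n ∸ l) !) ⟩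
    c ℚ.* fromℕ (l ! ℕ.* (n ∸ l) !)              ≡⟨ cong (c ℚ.*_) (fromℕ-homo-* (l !) ((n ∸ l) !)) ⟩
    c ℚ.* (p ℚ.* q)                              ∎
  F≡ : divT F l ≡ a ℚ.* β
  F≡ = ≡.trans (≡.sym (1/suc*fromℕ-cancel l (F (suc l)))) (cong (a ℚ.*_) (∂Li₂[1-e⁻ᵗ]≈t/[eᵗ-1] l))

-- Transfer of rational series to the algebra.

module Extension {c ℓ} (A : ℚ-Algebra c ℓ) where
  open ℚ-Algebra A
  open SecondKind A
  open Series commutativeRing using () renaming (_·_ to _·ᴬ_)
  open SeriesProperties commutativeRing using () renaming (_≈ˢ_ to _≈ᴬ_)
  open IsRingHomomorphism ι-isRingHomomorphism using (+-homo; *-homo; 0#-homo; ⟦⟧-cong)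

  extend-cong : ∀ {f g} → f ≈ˢ g → extend f ≈ᴬ extend g
  extend-cong f≈g n = ⟦⟧-cong (f≈g n)

  extend-· : ∀ f g → extend (f · g) ≈ᴬ extend f ·ᴬ extend g
  extend-· f g zero    = trans (+-homo _ _) (+-cong (*-homo (f 0) (g 0)) 0#-homo)
  extend-· f g (suc n) =
    trans (+-homo _ _) (+-cong (*-homo (f 0) (g (suc n))) (extend-· (tail f) g n))

-- The convolution formula.

theorem1 : ∀ {c ℓ} (A : ℚ-Algebra c ℓ) →
    let open ℚ-Algebra A
        open SecondKind A
    in (x : Carrier) (n : ℕ) →
       polyBernoulli₂ (+ 2) n x
         ≈ ∑[ l ≤ n ] (ι (fromℕ (n C toℕ l) ℚ.* bernoulli (toℕ l) ℚ.* (+ 1 / suc (toℕ l)))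
                        * bernoulli₂ (n ∸ toℕ l) x)
theorem1 A x n = begin
  ι (fromℕ (n !)) * (extend (D · L) ·ᴬ [1+t]^ x) n
    ≈⟨ *-congˡ (·ᴬ-congʳ {[1+t]^ x} (extend-· D L) n) ⟩
  ι (fromℕ (n !)) * ((extend D ·ᴬ extend L) ·ᴬ [1+t]^ x) n
    -- The factor t/log(1+t) is regrouped with (1+t)ˣ, so that `Q` is the generating function of the
    -- bₙ(x) and `D` carries the Bernoulli numbers.
    ≈⟨ *-congˡ (·ᴬ-assoc (extend D) (extend L) ([1+t]^ x) n) ⟩
  ι (fromℕ (n !)) * (extend D ·ᴬ Q) n
    ≈⟨ *-distribˡ-sum {suc n} (ι (fromℕ (n !))) (λ l → extend D (toℕ l) * Q (n ∸ toℕ l)) ⟩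
  ∑[ l ≤ n ] (ι (fromℕ (n !)) * (extend D (toℕ l) * Q (n ∸ toℕ l)))
    ≈⟨ sum-cong-≋ {suc n} (λ l → term (toℕ l) (ℕ.s≤s⁻¹ (Fin.toℕ<n l))) ⟩
  ∑[ l ≤ n ] (ι (coefficient (toℕ l)) * bernoulli₂ (n ∸ toℕ l) x) ∎
  where
  open ℚ-Algebra A
  open SecondKind A hiding (sum⁺-syntax)
  open Extension A
  open IsRingHomomorphism ι-isRingHomomorphism using (*-homo; ⟦⟧-cong)
  open SemiringSum semiring
  open SetoidReasoning (CommutativeRing.setoid commutativeRing)
  open Series commutativeRing using () renaming (_·_ to _·ᴬ_)
  open SeriesProperties commutativeRing using ()
    renaming (seriesRing to seriesRingᴬ; ·-assoc to ·ᴬ-assoc)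
  open CommutativeRing seriesRingᴬ using () renaming (*-congʳ to ·ᴬ-congʳ)
  D = divT (compose (Li (+ 2)) 1-e⁻ᵗ)
  L = inverse (divT log[1+t])
  Q = extend L ·ᴬ [1+t]^ x
  coefficient : ℕ → ℚ
  coefficient l = fromℕ (n C l) ℚ.* bernoulli l ℚ.* (+ 1 / suc l)
  term : ∀ l → l ≤ n → ι (fromℕ (n !)) * (extend D l * Q (n ∸ l))
                        ≈ ι (coefficient l) * bernoulli₂ (n ∸ l) x
  term l l≤n = begin
    ι (fromℕ (n !)) * (ι (D l) * Q (n ∸ l))
      ≈⟨ *-assoc _ _ _ ⟨
    ι (fromℕ (n !)) * ι (D l) * Q (n ∸ l)
      ≈⟨ *-congʳ (*-homo (fromℕ (n !)) (D l)) ⟨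
    ι (fromℕ (n !) ℚ.* D l) * Q (n ∸ l)
      ≈⟨ *-congʳ (⟦⟧-cong (binomial-bernoulli l≤n)) ⟩
    ι (coefficient l ℚ.* fromℕ ((n ∸ l) !)) * Q (n ∸ l)
      ≈⟨ *-congʳ (*-homo (coefficient l) (fromℕ ((n ∸ l) !))) ⟩
    ι (coefficient l) * ι (fromℕ ((n ∸ l) !)) * Q (n ∸ l)
      ≈⟨ *-assoc _ _ _ ⟩
    ι (coefficient l) * (ι (fromℕ ((n ∸ l) !)) * Q (n ∸ l))
      -- Read from right to left: `bernoulli₂` uses `quotient T log[1+t]`, which equals `L` because
      -- `divT T` is 1.
      ≈⟨ *-congˡ (*-congˡ (·ᴬ-congʳ {[1+t]^ x} (extend-cong (quotient-T log[1+t])) (n ∸ l))) ⟨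
    ι (coefficient l) * bernoulli₂ (n ∸ l) x ∎
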